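{- Let $k \geq 2$ and $0 \leq j \leq k-1$ be integers. For all $n \geq j+1$, $$B_n(k,j) = - \sum_{i=1}^{\lfloor \frac{n+1}{k+1} \rfloor} (-1)^i \binom{n-ik}{i-1} 2^{n+1-i(k+1)} + \sum_{i=1}^{\lfloor \frac{n-j}{k+1} \rfloor} (-1)^i \binom{n-j-1-ik}{i-1} 2^{n-j-i(k+1)}.$$
   Context: For integers $k \geq 2$ and $0 \leq j \leq k-1$, the sequence $\{B_n(k,j)\}_{n\geq 0}$ is defined by the recurrence $B_n(k,j) = B_{n-1}(k,j) + B_{n-2}(k,j)+\dots+B_{n-k}(k,j)$ for all $n \geq k$, with initial values $B_j(k,j)=1$ and $B_i(k,j)=0$ for $0 \leq i \leq k-1$, $i \neq j$. Empty sums are $0$. -}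

module Defs where

open import Data.Bool.Base using (if_then_else_)
open import Data.Integer.Base as ℤ using (ℤ; 0ℤ)
open import Data.List.Base using (List; []; _∷_; take; applyUpTo)
open import Data.Nat.Base using (ℕ; zero; suc; _∸_; _≤_; _<_; z≤n; s≤s)
open import Data.Nat.ListAction using (sum)
open import Data.Nat.Properties using (_<?_; _≟_; ≤⇒≯)
open import Relation.Binary.PropositionalEquality using (_≡_; _≢_; refl; cong)
open import Relation.Nullary.Decidable using (does; dec-true; dec-false)

-- ∑[ i ∈1⋯ m ] f i  =  f 1 + ⋯ + f m,  and 0 when m = 0.
∑₁ : ℕ → (ℕ → ℤ) → ℤ
∑₁ zero    f = 0ℤ
∑₁ (suc m) f = ∑₁ m f ℤ.+ f (suc m)

infix 5 ∑₁
syntax ∑₁ m (λ i → e) = ∑[ i ∈1⋯ m ] e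

-- B k j n is B_n(k,j).  The list earlier k j n is B_{n-1}, …, B_0, most recent
-- first, so for n ≥ k its first k entries are B_{n-1}, …, B_{n-k}.  The lemmas
-- below recover the initial values and the recurrence.
B       : ℕ → ℕ → ℕ → ℕ
earlier : ℕ → ℕ → ℕ → List ℕ

B k j n = if does (n <? k)
          then (if does (n ≟ j) then 1 else 0)
          else sum (take k (earlier k j n))

earlier k j zero    = []
earlier k j (suc n) = B k j n ∷ earlier k j n

B-initial-one : ∀ {k j} → j < k → B k j j ≡ 1
B-initial-one {k} {j} j<k
  rewrite dec-true (j <? k) j<k | dec-true (j ≟ j) refl = refl

B-initial-zero : ∀ {k j i} → i < k → i ≢ j → B k j i ≡ 0
B-initial-zero {k} {j} {i} i<k i≢j
  rewrite dec-true (i <? k) i<k | dec-false (i ≟ j) i≢j = refl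

take-earlier : ∀ k j {m n} → m ≤ n →
  take m (earlier k j n) ≡ applyUpTo (λ i → B k j (n ∸ suc i)) m
take-earlier k j z≤n               = refl
take-earlier k j (s≤s {n = n} m≤n) = cong (B k j n ∷_) (take-earlier k j m≤n)

B-recurrence : ∀ {k j n} → k ≤ n →
  B k j n ≡ sum (applyUpTo (λ i → B k j (n ∸ suc i)) k)
B-recurrence {k} {j} {n} k≤n
  rewrite dec-false (n <? k) (≤⇒≯ k≤n) = cong sum (take-earlier k j k≤n)

{-# OPTIONS --safe #-}

-- Write D p for the alternating sum with p = n + 1 in the first half of the
-- formula and p = n - j in the second, so that the claim reads
-- B_n = - D (n + 1) + D (n - j) for n > j.  Subtracting consecutive instances of
-- the defining recurrence gives B_{n+1} = 2 B_n - B_{n-k}, while Pascal's rule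
-- gives the same recurrence for D apart from a unit impulse: D is 0 up to k, and
-- D (k + 1 + l) is minus the coefficient of x^l in 1 / (1 - 2x + x^{k+1}).
-- Adding the impulse [n = j] makes the formula valid for all n, and then strong
-- induction along the common recurrence proves it.

module Submission where

open import Data.Bool.Base using (if_then_else_)
open import Data.Nat.Base using (ℕ; zero; suc; _≤_; _<_; _∸_; _/_; z≤n; s≤s; z<s)
open import Data.Nat.Combinatorics using (_C_; nCk+nC[k+1]≡[n+1]C[k+1]; k>n⇒nCk≡0)
open import Data.Nat.DivMod using (/-monoˡ-≤; m*n/n≡m; m<n⇒m/n≡0; m/n≡1+[m∸n]/n)
open import Data.Nat.Induction using (<-rec)
open import Data.Nat.ListAction using (sum)
open import Data.Nat.ListAction.Properties using (sum-++)
open import Data.Nat.Properties as ℕ using (_<?_; _≤?_; _≟_; ≰⇒>; ≤⇒≯; <⇒≱; ≤-<-connex)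
open import Data.Integer.Base using (ℤ; +_; -_; 0ℤ; -1ℤ; _+_; _-_; _*_; _^_)
open import Data.Integer.Properties as ℤ using (pos-+; pos-*)
open import Data.Integer.Tactic.RingSolver using (solve-∀)
open import Data.List.Base using ([]; _∷_; _++_; take; applyUpTo)
open import Data.List.Properties using (applyUpTo-∷ʳ)
open import Data.Sum.Base using (inj₁; inj₂)
open import Relation.Binary.PropositionalEquality
  using (_≡_; _≢_; refl; sym; trans; cong; cong₂; subst; module ≡-Reasoning)
open import Relation.Nullary.Decidable using (does; yes; no; dec-true; dec-false)
import Data.Nat.Base as ℕ
open import Defs using (B; earlier; ∑₁; B-initial-one; B-initial-zero; B-recurrence)

open ≡-Reasoning

-- Unit impulses.

δ : ℕ → ℕ → ℤ
δ n j = + (if does (n ≟ j) then 1 else 0)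

δ-refl : ∀ n → δ n n ≡ + 1
δ-refl n rewrite dec-true (n ≟ n) refl = refl

δ-≢ : ∀ {n j} → n ≢ j → δ n j ≡ 0ℤ
δ-≢ {n} {j} n≢j rewrite dec-false (n ≟ j) n≢j = refl

δ-+ : ∀ q j → δ (j ℕ.+ q) j ≡ δ q 0
δ-+ zero    j rewrite ℕ.+-identityʳ j = δ-refl j
δ-+ (suc q) j = δ-≢ (ℕ.m+1+n≢m j)

-- Coefficients of the powers of `2 - y`.

-- This is the coefficient of `y^i` in `(2 - y)^a`.
u : ℕ → ℕ → ℤ
u a i = -1ℤ ^ i * + (a C i) * (+ 2) ^ (a ∸ i)

u-vanishes : ∀ {a i} → a < i → u a i ≡ 0ℤ
u-vanishes {a} {i} a<i rewrite k>n⇒nCk≡0 a<i =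
  trans (cong (_* (+ 2) ^ (a ∸ i)) (ℤ.*-zeroʳ (-1ℤ ^ i))) (ℤ.*-zeroˡ ((+ 2) ^ (a ∸ i)))

u-zero : ∀ a → u (suc a) 0 ≡ + 2 * u a 0
u-zero a = lemma ((+ 2) ^ a)
  where
  lemma : ∀ p → + 1 * + 1 * (+ 2 * p) ≡ + 2 * (+ 1 * + 1 * p)
  lemma = solve-∀

C-2^-doubling : ∀ a i → + (a C suc i) * (+ 2) ^ (a ∸ i) ≡
                + 2 * (+ (a C suc i) * (+ 2) ^ (a ∸ suc i))
C-2^-doubling a i with ≤-<-connex (suc i) a
... | inj₁ i<a = trans
  (cong (λ e → + (a C suc i) * (+ 2) ^ e) (ℕ.+-∸-assoc 1 i<a))
  (lemma (+ (a C suc i)) ((+ 2) ^ (a ∸ suc i)))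
  where
  lemma : ∀ y p → y * (+ 2 * p) ≡ + 2 * (y * p)
  lemma = solve-∀
-- Here both truncated exponents are 0, so the powers do not double; the binomial coefficient
-- vanishes instead.
... | inj₂ a≤i = trans
  (cong (λ c → + c * (+ 2) ^ (a ∸ i)) (k>n⇒nCk≡0 a≤i))
  (sym (cong (λ c → + 2 * (+ c * (+ 2) ^ (a ∸ suc i))) (k>n⇒nCk≡0 a≤i)))

-- Compare coefficients of `y^(i+1)` in `(2 - y)^(a+1) = (2 - y) (2 - y)^a`.
u-pascal : ∀ a i → u (suc a) (suc i) ≡ + 2 * u a (suc i) - u a i
u-pascal a i = begin
  -1ℤ * s * + (suc a C suc i) * p
    ≡⟨ cong (λ c → -1ℤ * s * c * p)
         (trans (cong +_ (sym (nCk+nC[k+1]≡[n+1]C[k+1] a i))) (pos-+ (a C i) (a C suc i))) ⟩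
  -1ℤ * s * (x + y) * p
    ≡⟨ lemma₁ s x y p ⟩
  - s * (y * p) - s * x * p
    ≡⟨ cong (λ z → - s * z - s * x * p) (C-2^-doubling a i) ⟩
  - s * (+ 2 * (y * q)) - s * x * p
    ≡⟨ lemma₂ s x y p q ⟩
  + 2 * (-1ℤ * s * y * q) - s * x * p ∎
  where
  s x y p q : ℤ
  s = -1ℤ ^ i
  x = + (a C i)
  y = + (a C suc i)
  p = (+ 2) ^ (a ∸ i)
  q = (+ 2) ^ (a ∸ suc i)
  lemma₁ : ∀ s x y p → -1ℤ * s * (x + y) * p ≡ - s * (y * p) - s * x * p
  lemma₁ = solve-∀
  lemma₂ : ∀ s x y p q → - s * (+ 2 * (y * q)) - s * x * p ≡
                         + 2 * (-1ℤ * s * y * q) - s * x * p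
  lemma₂ = solve-∀

-- The power series of `1 / (1 - 2x + x^(k+1))`.

-- The series equals the sum over `a` of `x^a (2 - x^k)^a`. For `i * k ≤ l` this is the contribution
-- to `x^l` from `a = l - i * k`.
U : ℕ → ℕ → ℕ → ℤ
U k l i = u (l ∸ i ℕ.* k) i

U-vanishes : ∀ k {l i} → l / suc k < i → U k l i ≡ 0ℤ
U-vanishes k {l} {suc i} l/k<i with suc i ℕ.* suc k ≤? l
... | yes i*k≤l with () ← <⇒≱ l/k<i
  (subst (_≤ l / suc k) (m*n/n≡m (suc i) (suc k)) (/-monoˡ-≤ (suc k) i*k≤l))
... | no i*k≰l = u-vanishes (ℕ.m<n+o⇒m∸n<o l (suc i ℕ.* k)
  (subst (l <_) (trans (ℕ.*-suc (suc i) k) (ℕ.+-comm (suc i) _)) (≰⇒> i*k≰l)))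

U-recurrence : ∀ k q i → U k (suc (k ℕ.+ q)) (suc i) ≡ + 2 * U k (k ℕ.+ q) (suc i) - U k q i
U-recurrence k q i
  rewrite sym (ℕ.+-suc k q) | ℕ.[m+n]∸[m+o]≡n∸o k (suc q) (i ℕ.* k) | ℕ.[m+n]∸[m+o]≡n∸o k q (i ℕ.* k)
  with i | i ℕ.* k ≤? q
... | i     | yes i*k≤q rewrite ℕ.+-∸-assoc 1 i*k≤q = u-pascal (q ∸ i ℕ.* k) i
... | zero  | no  0≰q with () ← 0≰q z≤n
-- All three first arguments of `u` truncate to 0 while the second ones stay positive, so every term
-- vanishes.
... | suc i | no  i*k≰q
  rewrite ℕ.m≤n⇒m∸n≡0 (≰⇒> i*k≰q) | ℕ.m≤n⇒m∸n≡0 (ℕ.<⇒≤ (≰⇒> i*k≰q))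
  | u-vanishes {0} {suc i} z<s | u-vanishes {0} {suc (suc i)} z<s = refl

partialF : ℕ → ℕ → ℕ → ℤ
partialF k l zero    = U k l 0
partialF k l (suc m) = partialF k l m + U k l (suc m)

F : ℕ → ℕ → ℤ
F k l = partialF k l (l / suc k)

-- Lets sums with different floors as upper bounds be brought to a common bound, since the added
-- terms are zero.
partialF-stable : ∀ k l {m} → l / suc k ℕ.≤′ m → partialF k l m ≡ F k l
partialF-stable k l (ℕ.≤′-reflexive refl) = refl
partialF-stable k l (ℕ.≤′-step {n = m} l/k≤m)
  rewrite U-vanishes k {l} (s≤s (ℕ.≤′⇒≤ l/k≤m)) =
  trans (ℤ.+-identityʳ (partialF k l m)) (partialF-stable k l l/k≤m)

-- The term at index 0 merely doubles; each later one also subtracts the term of `q` with index one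
-- lower, hence the bound `m` against `suc m`.
partialF-recurrence : ∀ k q m → partialF k (suc (k ℕ.+ q)) (suc m) ≡
                      + 2 * partialF k (k ℕ.+ q) (suc m) - partialF k q m
partialF-recurrence k q zero
  rewrite U-recurrence k q 0 | u-zero (k ℕ.+ q) =
  lemma (U k (k ℕ.+ q) 0) (U k (k ℕ.+ q) 1) (U k q 0)
  where
  lemma : ∀ x y z → + 2 * x + (+ 2 * y - z) ≡ + 2 * (x + y) - z
  lemma = solve-∀
partialF-recurrence k q (suc m)
  rewrite U-recurrence k q (suc m) | partialF-recurrence k q m =
  lemma (partialF k (k ℕ.+ q) (suc m)) (U k (k ℕ.+ q) (suc (suc m)))
        (partialF k q m) (U k q (suc m))
  where
  lemma : ∀ x y z w → (+ 2 * x - z) + (+ 2 * y - w) ≡ + 2 * (x + y) - (z + w)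
  lemma = solve-∀

[d+n]/d≡1+n/d : ∀ d n .{{_ : ℕ.NonZero d}} → (d ℕ.+ n) / d ≡ suc (n / d)
[d+n]/d≡1+n/d d n = trans (m/n≡1+[m∸n]/n (ℕ.m≤m+n d n))
  (cong (λ m → suc (m / d)) (ℕ.m+n∸m≡n d n))

F-recurrence : ∀ k q → F k (suc (k ℕ.+ q)) ≡ + 2 * F k (k ℕ.+ q) - F k q
F-recurrence k q = begin
  F k (suc (k ℕ.+ q))
    ≡⟨ cong (partialF k _) k+q/k ⟩
  partialF k (suc (k ℕ.+ q)) (suc (q / suc k))
    ≡⟨ partialF-recurrence k q (q / suc k) ⟩
  + 2 * partialF k (k ℕ.+ q) (suc (q / suc k)) - F k q
    ≡⟨ cong (λ x → + 2 * x - F k q) (partialF-stable k (k ℕ.+ q) (ℕ.≤⇒≤′ bound)) ⟩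
  + 2 * F k (k ℕ.+ q) - F k q ∎
  where
  k+q/k : suc (k ℕ.+ q) / suc k ≡ suc (q / suc k)
  k+q/k = [d+n]/d≡1+n/d (suc k) q
  bound : (k ℕ.+ q) / suc k ≤ suc (q / suc k)
  bound = subst ((k ℕ.+ q) / suc k ≤_) k+q/k (/-monoˡ-≤ (suc k) (ℕ.n≤1+n (k ℕ.+ q)))

F-initial : ∀ {k l} → l < suc k → F k l ≡ u l 0
F-initial l<1+k rewrite m<n⇒m/n≡0 l<1+k = refl

F-initial-step : ∀ {k l} → l < k → F k (suc l) ≡ + 2 * F k l
F-initial-step {k} {l} l<k
  rewrite F-initial {k} (s≤s l<k) | F-initial {k} (ℕ.m<n⇒m<1+n l<k) = u-zero l

-- The alternating sum of the theorem.

term : ℕ → ℕ → ℕ → ℤ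
term k p i = -1ℤ ^ i * + ((p ∸ 1 ∸ i ℕ.* k) C (i ∸ 1)) * (+ 2) ^ (p ∸ i ℕ.* suc k)

D : ℕ → ℕ → ℤ
D k p = ∑₁ (p / suc k) (term k p)

-- The shift from `i` to `suc i` costs one factor -1 and uses up the summand `suc k` of the
-- argument.
term≡-U : ∀ k l i → term k (suc k ℕ.+ l) (suc i) ≡ - U k l i
term≡-U k l i
  rewrite ℕ.[m+n]∸[m+o]≡n∸o k l (i ℕ.* k) | ℕ.[m+n]∸[m+o]≡n∸o k l (i ℕ.* suc k)
  | ℕ.*-suc i k | ℕ.+-comm i (i ℕ.* k) | sym (ℕ.∸-+-assoc l (i ℕ.* k) i) =
  lemma (-1ℤ ^ i) (+ ((l ∸ i ℕ.* k) C i)) ((+ 2) ^ (l ∸ i ℕ.* k ∸ i))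
  where
  lemma : ∀ s x p → -1ℤ * s * x * p ≡ - (s * x * p)
  lemma = solve-∀

∑-term≡-partialF : ∀ k l m → ∑₁ (suc m) (term k (suc k ℕ.+ l)) ≡ - partialF k l m
∑-term≡-partialF k l zero    = trans (ℤ.+-identityˡ (term k (suc k ℕ.+ l) 1)) (term≡-U k l 0)
∑-term≡-partialF k l (suc m) = trans
  (cong₂ _+_ (∑-term≡-partialF k l m) (term≡-U k l (suc m)))
  (sym (ℤ.neg-distrib-+ (partialF k l m) (U k l (suc m))))

D≡-F : ∀ k l → D k (suc k ℕ.+ l) ≡ - F k l
D≡-F k l = trans (cong (λ m → ∑₁ m (term k (suc k ℕ.+ l))) ([d+n]/d≡1+n/d (suc k) l))
  (∑-term≡-partialF k l (l / suc k))

D-vanishes : ∀ {k p} → p ≤ k → D k p ≡ 0ℤ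
D-vanishes p≤k rewrite m<n⇒m/n≡0 (s≤s p≤k) = refl

D-recurrence : ∀ k q → D k (suc (k ℕ.+ q)) ≡ + 2 * D k (k ℕ.+ q) - D k q - δ q 0
D-recurrence k zero
  rewrite D≡-F k 0 | F-initial {k} {0} z<s | D-vanishes (ℕ.≤-reflexive (ℕ.+-identityʳ k)) = refl
D-recurrence k (suc l)
  rewrite D≡-F k (suc l) | ℕ.+-suc k l | D≡-F k l with ≤-<-connex (suc l) k
-- The argument `suc l` is still at most `k`, so the subtracted `D` is zero and only doubling
-- remains.
... | inj₁ l<k rewrite D-vanishes l<k | F-initial-step l<k = lemma (F k l)
  where
  lemma : ∀ x → - (+ 2 * x) ≡ + 2 * - x - 0ℤ - 0ℤ
  lemma = solve-∀
... | inj₂ (s≤s k≤l) rewrite sym (ℕ.m+[n∸m]≡n k≤l) | D≡-F k (l ∸ k) | F-recurrence k (l ∸ k) =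
  lemma (F k (k ℕ.+ (l ∸ k))) (F k (l ∸ k))
  where
  lemma : ∀ x y → - (+ 2 * x - y) ≡ + 2 * - x - - y - 0ℤ
  lemma = solve-∀

1+m+n∸o≤m : ∀ m {n o} → n < o → suc (m ℕ.+ n) ∸ o ≤ m
1+m+n∸o≤m m {n} {o} n<o = ℕ.m≤n+o⇒m∸n≤o (suc (m ℕ.+ n)) o
  (subst (_≤ o ℕ.+ m) (cong suc (ℕ.+-comm n m)) (ℕ.+-monoˡ-≤ m n<o))

D-recurrence-∸ : ∀ k j r → D k (suc (k ℕ.+ r) ∸ j) ≡
                 + 2 * D k (k ℕ.+ r ∸ j) - D k (r ∸ j) - δ r j
D-recurrence-∸ k j r with ≤-<-connex j r
... | inj₁ j≤r
  rewrite sym (ℕ.+-suc k r) | ℕ.+-∸-assoc k (ℕ.m≤n⇒m≤1+n j≤r) | ℕ.+-∸-assoc k j≤r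
  | ℕ.+-∸-assoc 1 j≤r | ℕ.+-suc k (r ∸ j) = begin
  D k (suc (k ℕ.+ (r ∸ j)))                           ≡⟨ D-recurrence k (r ∸ j) ⟩
  + 2 * D k (k ℕ.+ (r ∸ j)) - D k (r ∸ j) - δ (r ∸ j) 0
    ≡⟨ cong (λ x → + 2 * D k (k ℕ.+ (r ∸ j)) - D k (r ∸ j) - x) (sym (δ-+ (r ∸ j) j)) ⟩
  + 2 * D k (k ℕ.+ (r ∸ j)) - D k (r ∸ j) - δ (j ℕ.+ (r ∸ j)) j
    ≡⟨ cong (λ x → + 2 * D k (k ℕ.+ (r ∸ j)) - D k (r ∸ j) - δ x j) (ℕ.m+[n∸m]≡n j≤r) ⟩
  + 2 * D k (k ℕ.+ (r ∸ j)) - D k (r ∸ j) - δ r j     ∎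
-- All three arguments of `D` are at most `k` and the impulse has not yet occurred, so both sides
-- are zero.
... | inj₂ r<j
  rewrite D-vanishes {k} {suc (k ℕ.+ r) ∸ j} (1+m+n∸o≤m k r<j)
  | D-vanishes {k} {k ℕ.+ r ∸ j} (ℕ.≤-trans (ℕ.∸-monoˡ-≤ j (ℕ.n≤1+n (k ℕ.+ r))) (1+m+n∸o≤m k r<j))
  | ℕ.m≤n⇒m∸n≡0 (ℕ.<⇒≤ r<j) | δ-≢ (ℕ.<⇒≢ r<j) = refl

-- Doubling recurrence and first values of `B`.

sum-applyUpTo-suc : ∀ f n → sum (applyUpTo f (suc n)) ≡ sum (applyUpTo f n) ℕ.+ f n
sum-applyUpTo-suc f n = begin
  sum (applyUpTo f (suc n))            ≡⟨ cong sum (applyUpTo-∷ʳ f n) ⟨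
  sum (applyUpTo f n ++ f n ∷ [])      ≡⟨ sum-++ (applyUpTo f n) (f n ∷ []) ⟩
  sum (applyUpTo f n) ℕ.+ (f n ℕ.+ 0)  ≡⟨ cong (sum (applyUpTo f n) ℕ.+_) (ℕ.+-identityʳ (f n)) ⟩
  sum (applyUpTo f n) ℕ.+ f n          ∎

-- Split the sum of the `k + 1` values from index `k + r` down to `r` in two ways: removing the
-- oldest leaves `B k j (suc (k + r))`, removing the newest leaves `B k j (k + r)`.
B-doubling : ∀ k j r → B k j (suc (k ℕ.+ r)) ℕ.+ B k j r ≡ 2 ℕ.* B k j (k ℕ.+ r)
B-doubling k j r = begin
  B k j (suc n) ℕ.+ B k j r
    ≡⟨ cong₂ ℕ._+_ (B-recurrence (ℕ.m≤n⇒m≤1+n k≤n)) (cong (B k j) (sym (ℕ.m+n∸m≡n k r))) ⟩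
  sum (applyUpTo f k) ℕ.+ f k
    ≡⟨ sum-applyUpTo-suc f k ⟨
  B k j n ℕ.+ sum (applyUpTo (λ i → f (suc i)) k)
    ≡⟨ cong (B k j n ℕ.+_) (B-recurrence k≤n) ⟨
  B k j n ℕ.+ B k j n
    ≡⟨ cong (B k j n ℕ.+_) (ℕ.+-identityʳ (B k j n)) ⟨
  2 ℕ.* B k j n ∎
  where
  n : ℕ
  n = k ℕ.+ r
  f : ℕ → ℕ
  f i = B k j (n ∸ i)
  k≤n : k ≤ n
  k≤n = ℕ.m≤m+n k r

sum-earlier-≤ : ∀ {k j} m → j < k → m ≤ j → sum (earlier k j m) ≡ 0
sum-earlier-≤ zero    j<k m≤j = refl
sum-earlier-≤ (suc m) j<k m<j = cong₂ ℕ._+_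
  (B-initial-zero (ℕ.<-trans m<j j<k) (ℕ.<⇒≢ m<j)) (sum-earlier-≤ m j<k (ℕ.<⇒≤ m<j))

sum-earlier-> : ∀ {k j} m → m ≤ k → j < m → sum (earlier k j m) ≡ 1
sum-earlier-> {k} {j} (suc m) m<k (s≤s j≤m) with ℕ.m≤n⇒m<n∨m≡n j≤m
... | inj₁ j<m  = cong₂ ℕ._+_ (B-initial-zero m<k (ℕ.>⇒≢ j<m)) (sum-earlier-> m (ℕ.<⇒≤ m<k) j<m)
... | inj₂ refl = cong₂ ℕ._+_ (B-initial-one m<k) (sum-earlier-≤ m m<k ℕ.≤-refl)

take-earlier-all : ∀ k j m → take m (earlier k j m) ≡ earlier k j m
take-earlier-all k j zero    = refl
take-earlier-all k j (suc m) = cong (B k j m ∷_) (take-earlier-all k j m)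

B-initial : ∀ {k j n} → n < k → + B k j n ≡ δ n j
B-initial {k} {j} {n} n<k rewrite dec-true (n <? k) n<k = refl

-- The doubling recurrence first yields the value at `k + 1`, so index `k` is a base case of its
-- own.
B-at-k : ∀ {k j} → j < k → B k j k ≡ 1
B-at-k {k} {j} j<k rewrite dec-false (k <? k) (≤⇒≯ ℕ.≤-refl) | take-earlier-all k j k =
  sum-earlier-> k ℕ.≤-refl j<k

-- The corrected formula and its induction.

Formula : ℕ → ℕ → ℕ → Set
Formula k j n = + B k j n ≡ - D k (suc n) + D k (n ∸ j) + δ n j

formula-initial : ∀ {k j n} → n < k → Formula k j n
formula-initial {k} {j} {n} n<k
  rewrite B-initial {k} {j} n<k | D-vanishes n<k | D-vanishes (ℕ.≤-trans (ℕ.m∸n≤m n j) (ℕ.<⇒≤ n<k)) =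
  sym (ℤ.+-identityˡ (δ n j))

formula-at-k : ∀ {k j} → j < k → Formula k j k
formula-at-k {k} {j} j<k
  rewrite B-at-k j<k | δ-≢ (ℕ.>⇒≢ j<k) | D-vanishes (ℕ.m∸n≤m k j)
  | sym (cong (λ n → D k (suc n)) (ℕ.+-identityʳ k)) | D≡-F k 0 | F-initial {k} {0} z<s = refl

formula-step : ∀ {k j} r → j < k → Formula k j r → Formula k j (k ℕ.+ r) →
               Formula k j (suc (k ℕ.+ r))
formula-step {k} {j} r j<k at-r at-k+r = begin
  + b″
    ≡⟨ lemma₁ (+ b″) (+ b) ⟩
  + b″ + + b - + b
    ≡⟨ cong (_- + b) (trans (sym (pos-+ b″ b)) (trans (cong +_ (B-doubling k j r)) (pos-* 2 b′))) ⟩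
  + 2 * + b′ - + b
    ≡⟨ cong₂ (λ x y → + 2 * x - y)
         (trans at-k+r (cong (λ d → - x′ + y′ + d) (δ-≢ (ℕ.>⇒≢ (ℕ.<-≤-trans j<k (ℕ.m≤m+n k r)))))) at-r ⟩
  -- The correction `δ r j` inherited from index `r` is exactly the impulse in the recurrence of the
  -- second `D`.
  + 2 * (- x′ + y′ + 0ℤ) - (- x + y + δ r j)
    ≡⟨ lemma₂ x x′ y y′ (δ r j) ⟩
  - (+ 2 * x′ - x - 0ℤ) + (+ 2 * y′ - y - δ r j) + 0ℤ
    ≡⟨ cong₂ _+_ (cong₂ (λ x y → - x + y) (sym D-first) (sym (D-recurrence-∸ k j r)))
         (sym (δ-≢ (ℕ.>⇒≢ (ℕ.m<n⇒m<1+n (ℕ.<-≤-trans j<k (ℕ.m≤m+n k r)))))) ⟩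
  - D k (suc (suc (k ℕ.+ r))) + D k (suc (k ℕ.+ r) ∸ j) + δ (suc (k ℕ.+ r)) j ∎
  where
  b b′ b″ : ℕ
  b  = B k j r
  b′ = B k j (k ℕ.+ r)
  b″ = B k j (suc (k ℕ.+ r))
  x x′ y y′ : ℤ
  x  = D k (suc r)
  x′ = D k (suc (k ℕ.+ r))
  y  = D k (r ∸ j)
  y′ = D k (k ℕ.+ r ∸ j)
  D-first : D k (suc (suc (k ℕ.+ r))) ≡ + 2 * x′ - x - 0ℤ
  -- Taken at the positive index `suc r`, where the impulse computes to 0.
  D-first = subst (λ n → D k (suc n) ≡ + 2 * D k n - x - 0ℤ) (ℕ.+-suc k r) (D-recurrence k (suc r))
  lemma₁ : ∀ x y → x ≡ x + y - y
  lemma₁ = solve-∀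
  lemma₂ : ∀ x x′ y y′ d → + 2 * (- x′ + y′ + 0ℤ) - (- x + y + d) ≡
                           - (+ 2 * x′ - x - 0ℤ) + (+ 2 * y′ - y - d) + 0ℤ
  lemma₂ = solve-∀

formula : ∀ {k j} → j < k → ∀ n → Formula k j n
formula {k} {j} j<k = <-rec (Formula k j) step
  where
  step : ∀ n → (∀ {m} → m < n → Formula k j m) → Formula k j n
  step n rec with ≤-<-connex k n
  ... | inj₂ n<k = formula-initial n<k
  ... | inj₁ k≤n with ℕ.m≤n⇒m<n∨m≡n k≤n
  ...   | inj₂ refl = formula-at-k j<k
  ...   | inj₁ (s≤s {n = m} k≤m) with m ∸ k | ℕ.m+[n∸m]≡n k≤m
  ...     | r | refl = formula-step r j<k (rec (s≤s (ℕ.m≤n+m r k))) (rec ℕ.≤-refl)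

theorem3 : (k j : ℕ) → 2 ≤ k → j < k → (n : ℕ) → j ℕ.+ 1 ≤ n →
    + B k j n ≡
      - (∑[ i ∈1⋯ suc n / suc k ]
           -1ℤ ^ i * + ((n ∸ i ℕ.* k) C (i ∸ 1)) * (+ 2) ^ (suc n ∸ i ℕ.* suc k))
      + (∑[ i ∈1⋯ (n ∸ j) / suc k ]
           -1ℤ ^ i * + ((n ∸ j ∸ 1 ∸ i ℕ.* k) C (i ∸ 1)) * (+ 2) ^ (n ∸ j ∸ i ℕ.* suc k))
theorem3 k j _ j<k n j<n = begin
  + B k j n                             ≡⟨ formula j<k n ⟩
  - D k (suc n) + D k (n ∸ j) + δ n j   ≡⟨ cong (λ d → - D k (suc n) + D k (n ∸ j) + d) (δ-≢ (ℕ.>⇒≢ j<n′)) ⟩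
  - D k (suc n) + D k (n ∸ j) + 0ℤ      ≡⟨ ℤ.+-identityʳ (- D k (suc n) + D k (n ∸ j)) ⟩
  -- Unfolding `D` gives the stated sums, as `suc n ∸ 1` computes to `n`.
  - D k (suc n) + D k (n ∸ j)           ∎
  where
  j<n′ : j < n
  j<n′ = subst (_≤ n) (ℕ.+-comm j 1) j<n
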